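{- For every prime power $q$ and every integer $n \geq 1$, the domination number of $\Gamma_{l-i}(M_n(F_q))$ is $1$.
   Context: $F_q$ is the finite field with $q$ elements and $M_n(F_q)$ is the ring of all $n\times n$ matrices over $F_q$. For $X \in M_n(F_q)$, $[X] = \{AX : A \in M_n(F_q)\}$ is the left ideal generated by $X$. The undirected left-ideal relation graph $\Gamma_{l-i}(M_n(F_q))$ is the simple graph with vertex set $M_n(F_q)$ in which two distinct vertices $X, Y$ are adjacent if and only if $[X] \subset [Y]$ or $[Y] \subset [X]$, where $\subset$ denotes proper containment. A dominating set of a graph $\Gamma$ is a subset $D$ of $V(\Gamma)$ such that every vertex of $V(\Gamma)\setminus D$ is adjacent to at least one vertex of $D$; the domination number (also called dominance number) is the minimum size of a dominating set. -}

module Defs where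

open import Level using (Level; _⊔_; suc)
open import Algebra.Bundles using (CommutativeRing; Ring)
open import Algebra.Apartness.Bundles
  using (HeytingField; HeytingCommutativeRing)
import Algebra.Properties.Semiring.Sum as Sum
open import Data.Fin.Base using (Fin)
open import Data.List.Base using (List; length)
import Data.List.Membership.Setoid as Membership
import Data.List.Relation.Unary.Unique.Setoid as Unique
open import Data.Nat.Base as ℕ using (ℕ)
open import Data.Nat.Primality using (Prime)
open import Data.Product.Base using (∃-syntax; _×_; _,_; proj₁)
open import Data.Sum.Base as ⊎ using (_⊎_)
import Data.Vec.Functional.Relation.Binary.Equality.Setoid as VectorEquality
open import Function.Base using (_∘_)
open import Function.Bundles using (Inverse)
open import Relation.Binary.Bundles using (Setoid)
open import Relation.Binary.Core using (Rel)
open import Relation.Binary.Definitions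
  using (Irreflexive; Symmetric; _Respects₂_)
open import Relation.Binary.PropositionalEquality.Core using (_≡_)
open import Relation.Binary.PropositionalEquality.Properties as ≡ using ()
open import Relation.Nullary.Negation.Core using (¬_)
open import Relation.Unary using (Pred; _⊆_; _⊂_)

IsPrimePower : ℕ → Set
IsPrimePower q = ∃[ p ] ∃[ k ] Prime p × 1 ℕ.≤ k × q ≡ p ℕ.^ k

-- A setoid with exactly k elements, counted up to its equality.
HasCardinality : ∀ {a ℓ} → Setoid a ℓ → ℕ → Set (a ⊔ ℓ)
HasCardinality S k = Inverse S (≡.setoid (Fin k))

-- Equality on a finite carrier is decidable, so every finite field in the
-- textbook sense is a HeytingField with apartness x # y = ¬ (x ≈ y).
-- Conversely, irreflexivity of # excludes the zero ring, and with decidable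
-- equality on a finite carrier each x that is not ≈ 0# is invertible.
record FiniteField c ℓ₁ ℓ₂ (q : ℕ) : Set (suc (c ⊔ ℓ₁ ⊔ ℓ₂)) where
  field
    heytingField : HeytingField c ℓ₁ ℓ₂

  open HeytingField heytingField using (heytingCommutativeRing)
  open HeytingCommutativeRing heytingCommutativeRing public
    using (commutativeRing)
  open CommutativeRing commutativeRing public using (ring; setoid)

  field
    cardinality : HasCardinality setoid q

record SimpleGraph a ℓ e : Set (suc (a ⊔ ℓ ⊔ e)) where
  field
    vertices : Setoid a ℓ

  open Setoid vertices public using (_≈_) renaming (Carrier to Vertex)

  field
    Adjacent          : Rel Vertex e
    adjacent-resp-≈   : Adjacent Respects₂ _≈_
    adjacent-sym      : Symmetric Adjacent
    adjacent-irrefl   : Irreflexive _≈_ Adjacent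

module Domination {a ℓ e} (G : SimpleGraph a ℓ e) where
  open SimpleGraph G
  open Membership vertices using (_∈_; _∉_)
  open Unique vertices using (Unique)

  -- Finite sets of vertices are duplicate-free lists (up to the vertex
  -- equality), so that the size of a set is the length of the list.
  IsDominatingSet : List Vertex → Set (a ⊔ ℓ ⊔ e)
  IsDominatingSet D =
    Unique D × (∀ v → v ∉ D → ∃[ d ] d ∈ D × Adjacent v d)

  IsDominationNumber : ℕ → Set (a ⊔ ℓ ⊔ e)
  IsDominationNumber k =
      (∃[ D ] IsDominatingSet D × length D ≡ k)
    × (∀ D → IsDominatingSet D → k ℕ.≤ length D)

open Domination public using (IsDominationNumber)

module Matrices {c ℓ} (R : Ring c ℓ) (n : ℕ) where
  open Ring R using (Carrier; _*_; setoid; semiring; *-congˡ)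
  open Sum semiring using (sum-syntax; sum-cong-≋)

  Matrix : Set c
  Matrix = Fin n → Fin n → Carrier

  matrixSetoid : Setoid c ℓ
  matrixSetoid = ≋-setoid n
    where open VectorEquality (VectorEquality.≋-setoid setoid n)

  open Setoid matrixSetoid using (_≈_; refl; sym; trans)

  infixl 7 _·_
  _·_ : Matrix → Matrix → Matrix
  (A · B) i j = ∑[ k < n ] (A i k * B k j)

  ·-congˡ : ∀ A {X Y} → X ≈ Y → A · X ≈ A · Y
  ·-congˡ A X≈Y i j = sum-cong-≋ (λ k → *-congˡ (X≈Y k j))

  LeftIdeal : Matrix → Pred Matrix (c ⊔ ℓ)
  LeftIdeal X Y = ∃[ A ] Y ≈ A · X

  LeftIdeal-cong : ∀ {X Y} → X ≈ Y → LeftIdeal X ⊆ LeftIdeal Y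
  LeftIdeal-cong X≈Y (A , Z≈AX) = A , trans Z≈AX (·-congˡ A X≈Y)

  ⊂-resp : ∀ {X X′ Y Y′} → X ≈ X′ → Y ≈ Y′ →
           LeftIdeal X ⊂ LeftIdeal Y → LeftIdeal X′ ⊂ LeftIdeal Y′
  ⊂-resp {X} {X′} {Y} {Y′} p q (X⊆Y , Y⊈X) =
    (λ {Z} z → LeftIdeal-cong {Y} {Y′} q (X⊆Y (LeftIdeal-cong {X′} {X} (sym p) {Z} z))) ,
    (λ Y′⊆X′ → Y⊈X (λ {Z} z →
      LeftIdeal-cong {X′} {X} (sym p) (Y′⊆X′ (LeftIdeal-cong {Y} {Y′} q {Z} z))))

  LeftIdealAdjacent : Rel Matrix (c ⊔ ℓ)
  LeftIdealAdjacent X Y =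
    ¬ (X ≈ Y) × (LeftIdeal X ⊂ LeftIdeal Y ⊎ LeftIdeal Y ⊂ LeftIdeal X)

  leftIdealGraph : SimpleGraph c ℓ (c ⊔ ℓ)
  leftIdealGraph = record
    { vertices        = matrixSetoid
    ; Adjacent        = LeftIdealAdjacent
    ; adjacent-resp-≈ =
        (λ {X} {Y} {Y′} q (X≉Y , X~Y) →
          (λ X≈Y′ → X≉Y (trans X≈Y′ (sym q))) ,
          ⊎.map (⊂-resp {X} {X} {Y} {Y′} refl q) (⊂-resp {Y} {Y′} {X} {X} q refl) X~Y) ,
        (λ {Y} {X} {X′} p (X≉Y , X~Y) →
          (λ X′≈Y → X≉Y (trans p X′≈Y)) ,
          ⊎.map (⊂-resp {X} {X′} {Y} {Y} p refl) (⊂-resp {Y} {Y} {X} {X′} refl p) X~Y)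
    ; adjacent-sym    = λ (X≉Y , X~Y) → X≉Y ∘ sym , ⊎.swap X~Y
    ; adjacent-irrefl = λ X≈Y X~Y → proj₁ X~Y X≈Y
    }

open Matrices public using (leftIdealGraph)

{-# OPTIONS --safe #-}
module Submission where

open import Defs
open import Algebra.Bundles using (Ring)
import Algebra.Properties.Semiring.Sum as Sum
open import Data.Fin.Base using (Fin; zero; suc)
open import Data.List.Base using ([]; _∷_; [_])
import Data.List.Relation.Unary.All as All
import Data.List.Relation.Unary.AllPairs as AllPairs
open import Data.List.Relation.Unary.Any using (here)
open import Data.Nat using (ℕ; zero; suc; _≤_; s≤s; z≤n)
open import Data.Product.Base using (_,_)
open import Data.Sum.Base using (inj₂)
open import Relation.Binary.Bundles using (Setoid)
open import Relation.Binary.PropositionalEquality.Core using (refl)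
open import Relation.Nullary.Negation.Core using (¬_)
open import Relation.Unary using (_⊂_)

-- The zero matrix alone dominates: [0] = {0} is contained in every [X], and
-- X = 1X lies in [X], so the containment is proper unless X = 0.

-- This bounds the domination number above by 1. It is not 0, because the vertex `0ᴹ` would need a
-- neighbour in the empty set. The strictness of `LeftIdeal-0⊂` rests on the left unit law, which
-- comes down to `sum-identityMatrix`.

module _ {c ℓ} (R : Ring c ℓ) where
  open Ring R using (Carrier; _≈_; _+_; _*_; 0#; 1#; setoid; semiring;
    zeroˡ; zeroʳ; *-identityˡ; +-cong; +-identityˡ; +-identityʳ; trans; sym)
  open Sum semiring using (sum-syntax; sum-cong-≋; sum-replicate-zero)
  open import Relation.Binary.Reasoning.Setoid setoid

  sum-zero : ∀ {n} {f : Fin n → Carrier} → (∀ k → f k ≈ 0#) → ∑[ k < n ] f k ≈ 0#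
  sum-zero {n} f≈0 = trans (sum-cong-≋ f≈0) (sum-replicate-zero n)

  -- Recursion on both indices makes each row split definitionally along with the sum over
  -- `Fin (suc n)`.
  identityMatrix : ∀ {n} → Fin n → Fin n → Carrier
  identityMatrix zero    zero    = 1#
  identityMatrix zero    (suc _) = 0#
  identityMatrix (suc _) zero    = 0#
  identityMatrix (suc i) (suc j) = identityMatrix i j

  -- Induction on `i`: either the head term survives and the tail vanishes, or the head vanishes and
  -- the tail is the same claim for `f` shifted by one.
  sum-identityMatrix : ∀ {n} (i : Fin n) (f : Fin n → Carrier) →
                       ∑[ k < n ] (identityMatrix i k * f k) ≈ f i
  sum-identityMatrix {suc n} zero f = begin
    1# * f zero + ∑[ k < n ] (0# * f (suc k))
      ≈⟨ +-cong (*-identityˡ _) (sum-zero (λ k → zeroˡ (f (suc k)))) ⟩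
    f zero + 0#
      ≈⟨ +-identityʳ _ ⟩
    f zero ∎
  sum-identityMatrix {suc n} (suc i) f = begin
    0# * f zero + ∑[ k < n ] (identityMatrix i k * f (suc k))
      ≈⟨ +-cong (zeroˡ _) (sum-identityMatrix i (λ k → f (suc k))) ⟩
    0# + f (suc i)
      ≈⟨ +-identityˡ _ ⟩
    f (suc i) ∎

  module _ (n : ℕ) where
    open Matrices R n using (Matrix; _·_; LeftIdeal; matrixSetoid)
    open Setoid matrixSetoid using () renaming (_≈_ to _≈ᴹ_)

    0ᴹ : Matrix
    0ᴹ _ _ = 0#

    ·-identityˡ : ∀ X → identityMatrix · X ≈ᴹ X
    ·-identityˡ X i j = sum-identityMatrix i (λ k → X k j)

    ·-zeroˡ : ∀ X → 0ᴹ · X ≈ᴹ 0ᴹ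
    ·-zeroˡ X i j = sum-zero (λ k → zeroˡ (X k j))

    ·-zeroʳ : ∀ A → A · 0ᴹ ≈ᴹ 0ᴹ
    ·-zeroʳ A i j = sum-zero (λ k → zeroʳ (A i k))

    LeftIdeal-0⊂ : ∀ {X} → ¬ (X ≈ᴹ 0ᴹ) → LeftIdeal 0ᴹ ⊂ LeftIdeal X
    LeftIdeal-0⊂ {X} X≉0 =
      -- Every `Z` in the ideal of `0ᴹ` is zero, hence equal to `0ᴹ · X`.
      (λ (A , Z≈A0) → 0ᴹ , λ i j →
        trans (Z≈A0 i j) (trans (·-zeroʳ A i j) (sym (·-zeroˡ X i j)))) ,
      λ [X]⊆[0] →
        -- Applying the reverse inclusion to `X` itself forces `X` to be a multiple of `0ᴹ`.
        let A , X≈A0 = [X]⊆[0] {X} (identityMatrix , λ i j → sym (·-identityˡ X i j))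
        in X≉0 λ i j → trans (X≈A0 i j) (·-zeroʳ A i j)

    dominationNumber≡1 : IsDominationNumber (leftIdealGraph R n) 1
    dominationNumber≡1 =
      ([ 0ᴹ ] , (All.[] AllPairs.∷ AllPairs.[] , dominated) , refl) , nonempty
      where
      open Domination (leftIdealGraph R n)

      dominated = λ X X∉[0] →
        -- Here `[0]` is the one-element list, so lying outside it means being nonzero.
        let X≉0 = λ X≈0 → X∉[0] (here X≈0)
        in 0ᴹ , here (λ _ _ → Ring.refl R) , X≉0 , inj₂ (LeftIdeal-0⊂ X≉0)

      nonempty : ∀ D → IsDominatingSet D → 1 ≤ _
      nonempty []      (_ , dom) with dom 0ᴹ (λ ())
      ... | _ , () , _
      nonempty (_ ∷ _) _ = s≤s z≤n

corollary4p5 : ∀ {c ℓ₁ ℓ₂} (q : ℕ) → IsPrimePower q →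
    (F : FiniteField c ℓ₁ ℓ₂ q) (n : ℕ) → 1 ≤ n →
    IsDominationNumber (leftIdealGraph (FiniteField.ring F) n) 1
corollary4p5 _ _ F n _ = dominationNumber≡1 (FiniteField.ring F) n
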